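{- Let $\mathbf v,\mathbf v_1,\mathbf v_2$ be three distinct vertices of $C^n$ and let $P=\mathrm{aff}(\mathbf v,\mathbf v_1,\mathbf v_2)$. Let $I,J\subseteq[n]$ be such that $\mathbf v_1={}_{ -I}\mathbf v$ and $\mathbf v_2={}_{ -J}\mathbf v$. Then exactly one of the following occurs: (1) $I\cap J=\emptyset$ and $P\cap C^n=\{\mathbf v,\mathbf v_1,\mathbf v_2,\mathbf v_3\}$ where $\mathbf v_3={}_{ -(I\cup J)}\mathbf v$; (2) $I\subset J$ (resp. $J\subset I$) and $P\cap C^n=\{\mathbf v,\mathbf v_1,\mathbf v_2,\mathbf v_3\}$ where $\mathbf v_3={}_{ -(J\setminus I)}\mathbf v$ (resp. $\mathbf v_3={}_{ -(I\setminus J)}\mathbf v$); (3) $I\cap J$, $I\setminus J$ and $J\setminus I$ are all nonempty and $P\cap C^n=\{\mathbf v,\mathbf v_1,\mathbf v_2\}$.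
   Context: $C^n=\{ -1,1\}^n\subseteq\mathbb R^n$, $[n]=\{1,\dots,n\}$. For $\mathbf v\in C^n$ and $I\subseteq[n]$, ${}_{ -I}\mathbf v$ denotes the vertex of $C^n$ obtained from $\mathbf v$ by reversing the signs of the entries indexed by $I$. $\mathrm{aff}$ denotes affine span in $\mathbb R^n$.
   Formalization: The plane $P=\mathrm{aff}(\mathbf v,\mathbf v_1,\mathbf v_2)$ is the affine span over ℚ, with rational affine coefficients, instead of the affine span in ℝ^n. -}

module Defs where

open import Data.Nat using (ℕ)
open import Data.Bool using (Bool; true; false)
open import Data.Fin using (Fin)
open import Data.Fin.Subset using (Subset; _∩_; _∪_; _─_; _⊂_; Empty; Nonempty)
open import Data.Vec using (Vec; zipWith; lookup)
open import Data.Sign using (Sign; opposite)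
import Data.Sign as S
open import Data.Rational using (ℚ; 1ℚ; _+_; _*_; -_)
open import Data.Product using (_×_; ∃; Σ-syntax)
open import Data.Sum using (_⊎_)
open import Relation.Binary.PropositionalEquality using (_≡_)
open import Relation.Nullary using (¬_)

-- A vertex of the cube C^n = {-1,1}^n : a vector of signs.
Vertex : ℕ → Set
Vertex n = Vec Sign n

-- The real (here: rational) value ±1 of a sign.
sgn : Sign → ℚ
sgn S.+ = 1ℚ
sgn S.- = - 1ℚ

-- The point of Q^n ⊆ R^n corresponding to a vertex.
coord : ∀ {n} → Vertex n → Fin n → ℚ
coord v i = sgn (lookup v i)

-- ₋I v : reverse the signs of the entries of v indexed by I.
flipAt : Bool → Sign → Sign
flipAt true  s = opposite s
flipAt false s = s

flipSigns : ∀ {n} → Subset n → Vertex n → Vertex n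
flipSigns I v = zipWith flipAt I v

-- x ∈ aff(a, b, c): x is an affine combination of a, b, c.
InAff3 : ∀ {n} → (Fin n → ℚ) → (Fin n → ℚ) → (Fin n → ℚ) → (Fin n → ℚ) → Set
InAff3 a b c x =
  ∃ λ (α : ℚ) → ∃ λ (β : ℚ) → ∃ λ (γ : ℚ) →
    (α + β + γ ≡ 1ℚ) × (∀ i → x i ≡ α * a i + β * b i + γ * c i)

-- w ∈ P ∩ C^n with P = aff(v, v₁, v₂)
InPlane : ∀ {n} → Vertex n → Vertex n → Vertex n → Vertex n → Set
InPlane v v₁ v₂ w = InAff3 (coord v) (coord v₁) (coord v₂) (coord w)

-- P ∩ C^n = {v, v₁, v₂, v₃}
CubeSection4 : ∀ {n} → Vertex n → Vertex n → Vertex n → Vertex n → Set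
CubeSection4 v v₁ v₂ v₃ = ∀ w →
  (InPlane v v₁ v₂ w → (w ≡ v ⊎ w ≡ v₁ ⊎ w ≡ v₂ ⊎ w ≡ v₃)) ×
  ((w ≡ v ⊎ w ≡ v₁ ⊎ w ≡ v₂ ⊎ w ≡ v₃) → InPlane v v₁ v₂ w)

-- P ∩ C^n = {v, v₁, v₂}
CubeSection3 : ∀ {n} → Vertex n → Vertex n → Vertex n → Set
CubeSection3 v v₁ v₂ = ∀ w →
  (InPlane v v₁ v₂ w → (w ≡ v ⊎ w ≡ v₁ ⊎ w ≡ v₂)) ×
  ((w ≡ v ⊎ w ≡ v₁ ⊎ w ≡ v₂) → InPlane v v₁ v₂ w)

Case1 : ∀ {n} → Vertex n → Subset n → Subset n → Set
Case1 v I J = Empty (I ∩ J) ×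
  CubeSection4 v (flipSigns I v) (flipSigns J v) (flipSigns (I ∪ J) v)

Case2 : ∀ {n} → Vertex n → Subset n → Subset n → Set
Case2 v I J =
  (I ⊂ J × CubeSection4 v (flipSigns I v) (flipSigns J v) (flipSigns (J ─ I) v))
  ⊎ (J ⊂ I × CubeSection4 v (flipSigns I v) (flipSigns J v) (flipSigns (I ─ J) v))

Case3 : ∀ {n} → Vertex n → Subset n → Subset n → Set
Case3 v I J = Nonempty (I ∩ J) × Nonempty (I ─ J) × Nonempty (J ─ I) ×
  CubeSection3 v (flipSigns I v) (flipSigns J v)

-- Exactly one of three propositions holds.
ExactlyOne : Set → Set → Set → Set
ExactlyOne A B C = (A ⊎ B ⊎ C) × ¬ (A × B) × ¬ (A × C) × ¬ (B × C)

{-# OPTIONS --safe #-}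
module Submission where

-- Multiplying coordinates by the signs of v is a symmetry of the cube that preserves affine
-- relations, so it suffices to treat v = (1,…,1). A vertex is then the sign vector ±K of the set K
-- of its negative coordinates, and ±K ∈ aff(1, ±I, ±J) says that the sign of K at i is
-- α + β (-1)^[i ∈ I] + γ (-1)^[i ∈ J]. That value depends only on the type (i ∈ I, i ∈ J) of the
-- coordinate, so K is cut out by a pattern g : Bool → Bool → Bool which, on the types that occur, is
-- a ±1-valued affine function on the square with g(false,false) = false. If all four types occur,
-- the parallelogram law L(1,0) + L(0,1) = L(0,0) + L(1,1) leaves only the patterns of ∅, I and J.
-- If the type (1,1), (1,0) or (0,1) does not occur, its value is free and one more pattern becomes
-- admissible, that of I ∪ J, J ∖ I or I ∖ J respectively.

open import Defs
open import Data.Nat using (ℕ)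
open import Data.Fin.Subset using (Subset)
open import Relation.Binary.PropositionalEquality using (_≡_; _≢_)

open import Data.Bool using (Bool; true; false; not; _∧_; _∨_)
import Data.Bool as Bool
open import Data.Bool.Properties using (∧-zeroʳ; ∧-identityʳ)
open import Data.Empty using (⊥-elim)
open import Data.Fin using (Fin; zero; suc)
open import Data.Fin.Properties using (any?)
open import Data.Fin.Subset using (_∉_; _⊆_; _⊂_; _∩_; _∪_; _─_; ⊥; Nonempty)
open import Data.Product using (∃; _×_; _,_; uncurry)
open import Data.Rational using (ℚ; 0ℚ; 1ℚ; _+_; _*_; -_; _≤ᵇ_)
open import Data.Rational.Properties using (*-assoc; *-identityʳ)
open import Data.Rational.Solver using (module +-*-Solver)
import Data.Sign as S
open import Data.Sign.Properties using () renaming (_≟_ to _≟ˢ_)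
open import Data.Sum using (_⊎_; inj₁; inj₂)
import Data.Sum as Sum
open import Data.Vec using ([]; _∷_; lookup; zipWith)
open import Data.Vec.Properties using (lookup-zipWith; lookup-replicate; []=⇒lookup; lookup⇒[]=)
open import Data.Vec.Relation.Binary.Pointwise.Extensional using (ext; Pointwise-≡⇒≡)
open import Function using (_∘_; const)
open import Function.Bundles using (_⇔_; mk⇔; module Equivalence)
open import Relation.Binary.PropositionalEquality using (refl; sym; trans; cong; cong₂; subst; module ≡-Reasoning)
open import Relation.Nullary using (¬_; Dec; yes; no; does)
import Relation.Nullary.Decidable as Dec
open import Relation.Nullary.Decidable using (_×-dec_)

open Equivalence using (to; from)
open +-*-Solver

private
  variable
    n : ℕ
    a b : Bool
    g h : Bool → Bool → Bool
    Occ : Bool → Bool → Set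
    I J K X : Subset n

-- Signs and affine functions on the square

sgnᵇ : Bool → ℚ
sgnᵇ false = 1ℚ
sgnᵇ true  = - 1ℚ

negativeᵇ : ℚ → Bool
negativeᵇ q = q ≤ᵇ 0ℚ

sgnᵇ≡⇒negativeᵇ : ∀ b {q} → sgnᵇ b ≡ q → b ≡ negativeᵇ q
sgnᵇ≡⇒negativeᵇ false refl = refl
sgnᵇ≡⇒negativeᵇ true  refl = refl

sgn-flipAt : ∀ b s → sgn (flipAt b s) ≡ sgnᵇ b * sgn s
sgn-flipAt false S.+ = refl
sgn-flipAt false S.- = refl
sgn-flipAt true  S.+ = refl
sgn-flipAt true  S.- = refl

sgn*sgn≡1 : ∀ s → sgn s * sgn s ≡ 1ℚ
sgn*sgn≡1 S.+ = refl
sgn*sgn≡1 S.- = refl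

*-sgn-involutive : ∀ x s → x * sgn s * sgn s ≡ x
*-sgn-involutive x s = trans (*-assoc x (sgn s) (sgn s)) (trans (cong (x *_) (sgn*sgn≡1 s)) (*-identityʳ x))

*-sgn-cancelʳ : ∀ {x y} s → x * sgn s ≡ y * sgn s → x ≡ y
*-sgn-cancelʳ {x} {y} s eq =
  trans (sym (*-sgn-involutive x s)) (trans (cong (_* sgn s) eq) (*-sgn-involutive y s))

affine : ℚ → ℚ → ℚ → Bool → Bool → ℚ
affine α β γ a b = α * 1ℚ + β * sgnᵇ a + γ * sgnᵇ b

*-distribʳ-combination : ∀ α β γ x y σ →
  α * σ + β * (x * σ) + γ * (y * σ) ≡ (α * 1ℚ + β * x + γ * y) * σ
*-distribʳ-combination = solve 6 (λ α β γ x y σ →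
  α :* σ :+ β :* (x :* σ) :+ γ :* (y :* σ) := (α :* con 1ℚ :+ β :* x :+ γ :* y) :* σ) refl

affine-origin : ∀ α β γ → α + β + γ ≡ 1ℚ → affine α β γ false false ≡ 1ℚ
affine-origin α β γ = trans (solve 3 (λ α β γ →
  α :* con 1ℚ :+ β :* con 1ℚ :+ γ :* con 1ℚ := α :+ β :+ γ) refl α β γ)

affine-parallelogram : ∀ α β γ →
  affine α β γ true false + affine α β γ false true ≡ affine α β γ false false + affine α β γ true true
affine-parallelogram = solve 3 (λ α β γ →
    (α :* con 1ℚ :+ β :* con (- 1ℚ) :+ γ :* con 1ℚ) :+ (α :* con 1ℚ :+ β :* con 1ℚ :+ γ :* con (- 1ℚ))
  := (α :* con 1ℚ :+ β :* con 1ℚ :+ γ :* con 1ℚ) :+ (α :* con 1ℚ :+ β :* con (- 1ℚ) :+ γ :* con (- 1ℚ)))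
  refl

sgnᵇ-parallelogram : ∀ x y z → sgnᵇ x + sgnᵇ y ≡ 1ℚ + sgnᵇ z →
  (x ≡ false × y ≡ false × z ≡ false) ⊎ (x ≡ true × y ≡ false × z ≡ true) ⊎
  (x ≡ false × y ≡ true × z ≡ true)
sgnᵇ-parallelogram false false false _ = inj₁ (refl , refl , refl)
sgnᵇ-parallelogram true  false true  _ = inj₂ (inj₁ (refl , refl , refl))
sgnᵇ-parallelogram false true  true  _ = inj₂ (inj₂ (refl , refl , refl))
sgnᵇ-parallelogram false false true  ()
sgnᵇ-parallelogram true  false false ()
sgnᵇ-parallelogram false true  false ()
sgnᵇ-parallelogram true  true  false ()
sgnᵇ-parallelogram true  true  true  ()

-- Reduction to v = (1,…,1)

signVector : Subset n → Fin n → ℚ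
signVector K i = sgnᵇ (lookup K i)

coord-flipSigns : ∀ K (v : Vertex n) i → coord (flipSigns K v) i ≡ sgnᵇ (lookup K i) * coord v i
coord-flipSigns K v i = trans (cong sgn (lookup-zipWith flipAt i K v)) (sgn-flipAt (lookup K i) (lookup v i))

inPlane⇔inAff3 : ∀ (v : Vertex n) I J K →
  InPlane v (flipSigns I v) (flipSigns J v) (flipSigns K v) ⇔
  InAff3 (const 1ℚ) (signVector I) (signVector J) (signVector K)
inPlane⇔inAff3 v I J K = mk⇔
  (λ (α , β , γ , Σ≡1 , eq) → α , β , γ , Σ≡1 , λ i →
    *-sgn-cancelʳ (lookup v i) (trans (sym (coord-flipSigns K v i)) (trans (eq i) (factor-v α β γ i))))
  (λ (α , β , γ , Σ≡1 , eq) → α , β , γ , Σ≡1 , λ i →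
    trans (coord-flipSigns K v i) (trans (cong (_* coord v i) (eq i)) (sym (factor-v α β γ i))))
  where
  factor-v : ∀ α β γ i →
    α * coord v i + β * coord (flipSigns I v) i + γ * coord (flipSigns J v) i ≡
    (α * 1ℚ + β * signVector I i + γ * signVector J i) * coord v i
  factor-v α β γ i = trans
    (cong₂ (λ x y → α * coord v i + β * x + γ * y) (coord-flipSigns I v i) (coord-flipSigns J v i))
    (*-distribʳ-combination α β γ (signVector I i) (signVector J i) (coord v i))

flipAt-differs : ∀ s t → flipAt (not (does (s ≟ˢ t))) t ≡ s
flipAt-differs S.+ S.+ = refl
flipAt-differs S.+ S.- = refl
flipAt-differs S.- S.+ = refl
flipAt-differs S.- S.- = refl

_⊖_ : Vertex n → Vertex n → Subset n
w ⊖ v = zipWith (λ s t → not (does (s ≟ˢ t))) w v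

flipSigns-⊖ : ∀ (w v : Vertex n) → flipSigns (w ⊖ v) v ≡ w
flipSigns-⊖ []      []      = refl
flipSigns-⊖ (s ∷ w) (t ∷ v) = cong₂ _∷_ (flipAt-differs s t) (flipSigns-⊖ w v)

flipSigns-⊥ : ∀ (v : Vertex n) → flipSigns ⊥ v ≡ v
flipSigns-⊥ []      = refl
flipSigns-⊥ (s ∷ v) = cong (s ∷_) (flipSigns-⊥ v)

-- Membership patterns

record Occurs (I J : Subset n) (a b : Bool) : Set where
  constructor occurs
  field
    index : Fin n
    I-at  : lookup I index ≡ a
    J-at  : lookup J index ≡ b

record Follows (I J : Subset n) (g : Bool → Bool → Bool) (K : Subset n) : Set where
  constructor follows
  field at : ∀ i → lookup K i ≡ g (lookup I i) (lookup J i)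
open Follows

Agree : (Bool → Bool → Set) → (Bool → Bool → Bool) → (Bool → Bool → Bool) → Set
Agree Occ g h = ∀ a b → Occ a b → g a b ≡ h a b

record AffineOn (Occ : Bool → Bool → Set) (g : Bool → Bool → Bool) : Set where
  constructor affineOn
  field
    α β γ         : ℚ
    weights       : α + β + γ ≡ 1ℚ
    interpolation : ∀ {a b} → Occ a b → sgnᵇ (g a b) ≡ affine α β γ a b

occurs? : ∀ (I J : Subset n) a b → Dec (Occurs I J a b)
occurs? I J a b = Dec.map′ (λ (i , p , q) → occurs i p q) (λ (occurs i p q) → i , p , q)
  (any? λ i → (lookup I i Bool.≟ a) ×-dec (lookup J i Bool.≟ b))

occurs-swap : Occurs J I b a → Occurs I J a b
occurs-swap (occurs i p q) = occurs i q p

follows-unique : Follows I J g K → Follows I J h X → Agree (Occurs I J) g h → K ≡ X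
follows-unique K≐g X≐h g≈h = Pointwise-≡⇒≡ (ext λ i →
  trans (at K≐g i) (trans (g≈h _ _ (occurs i refl refl)) (sym (at X≐h i))))

-- Read off the affine function, `sign` needs no witnesses and is defined on all of Bool², but it is
-- tied to the signs of K only on the types that occur.
inAff3⇒pattern : InAff3 (const 1ℚ) (signVector I) (signVector J) (signVector K) →
  ∃ λ g → AffineOn (Occurs I J) g × Follows I J g K
inAff3⇒pattern {I = I} {J = J} {K = K} (α , β , γ , Σ≡1 , eq) =
  sign , affineOn α β γ Σ≡1 interpolation , follows λ i → sgnᵇ≡⇒negativeᵇ (lookup K i) (eq i)
  where
  sign : Bool → Bool → Bool
  sign a b = negativeᵇ (affine α β γ a b)
  interpolation : ∀ {a b} → Occurs I J a b → sgnᵇ (sign a b) ≡ affine α β γ a b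
  interpolation (occurs i refl refl) = trans (cong sgnᵇ (sym (sgnᵇ≡⇒negativeᵇ (lookup K i) (eq i)))) (eq i)

pattern⇒inAff3 : AffineOn (Occurs I J) g → Follows I J g K →
  InAff3 (const 1ℚ) (signVector I) (signVector J) (signVector K)
pattern⇒inAff3 (affineOn α β γ Σ≡1 interpolation) K≐g =
  α , β , γ , Σ≡1 , λ i → trans (cong sgnᵇ (at K≐g i)) (interpolation (occurs i refl refl))

agree : (Occ false false → g false false ≡ h false false) → (Occ true false → g true false ≡ h true false) →
        (Occ false true → g false true ≡ h false true) → (Occ true true → g true true ≡ h true true) →
        Agree Occ g h
agree ff tf ft tt false false = ff
agree ff tf ft tt true  false = tf
agree ff tf ft tt false true  = ft
agree ff tf ft tt true  true  = tt

affineOn-origin : AffineOn Occ g → Occ false false → g false false ≡ false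
affineOn-origin {g = g} (affineOn α β γ Σ≡1 interpolation) ff =
  sgnᵇ≡⇒negativeᵇ (g false false) (trans (interpolation ff) (affine-origin α β γ Σ≡1))

affineOn-parallelogram : AffineOn Occ g → Occ true false → Occ false true → Occ true true →
  sgnᵇ (g true false) + sgnᵇ (g false true) ≡ 1ℚ + sgnᵇ (g true true)
affineOn-parallelogram {g = g} (affineOn α β γ Σ≡1 interpolation) tf ft tt = begin
  sgnᵇ (g true false) + sgnᵇ (g false true)         ≡⟨ cong₂ _+_ (interpolation tf) (interpolation ft) ⟩
  affine α β γ true false + affine α β γ false true  ≡⟨ affine-parallelogram α β γ ⟩
  affine α β γ false false + affine α β γ true true
    ≡⟨ cong₂ _+_ (affine-origin α β γ Σ≡1) (sym (interpolation tt)) ⟩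
  1ℚ + sgnᵇ (g true true)                            ∎
  where open ≡-Reasoning

Among₃ : (Bool → Bool → Set) → (Bool → Bool → Bool) → Set
Among₃ Occ g = Agree Occ g (λ _ _ → false) ⊎ Agree Occ g (λ a _ → a) ⊎ Agree Occ g (λ _ b → b)

Among₄ : (Bool → Bool → Set) → (Bool → Bool → Bool) → (Bool → Bool → Bool) → Set
Among₄ Occ g h =
  Agree Occ g (λ _ _ → false) ⊎ Agree Occ g (λ a _ → a) ⊎ Agree Occ g (λ _ b → b) ⊎ Agree Occ g h

affineOn⇒among₃ : AffineOn Occ g → Occ true false → Occ false true → Occ true true → Among₃ Occ g
affineOn⇒among₃ {Occ = Occ} {g = g} A tf ft tt =
  Sum.map (agreeing refl) (Sum.map (agreeing refl) (agreeing refl))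
    (sgnᵇ-parallelogram _ _ _ (affineOn-parallelogram A tf ft tt))
  where
  agreeing : ∀ {h} → h false false ≡ false →
    g true false ≡ h true false × g false true ≡ h false true × g true true ≡ h true true → Agree Occ g h
  agreeing h₀ (p , q , r) = agree (λ ff → trans (affineOn-origin A ff) (sym h₀)) (const p) (const q) (const r)

affineOn⇒among₄-I∪J : AffineOn Occ g → ¬ Occ true true → Among₄ Occ g _∨_
affineOn⇒among₄-I∪J {g = g} A ¬tt with g true false in p | g false true in q
... | false | false = inj₁ (agree (affineOn-origin A) (const p) (const q) (⊥-elim ∘ ¬tt))
... | true  | false = inj₂ (inj₁ (agree (affineOn-origin A) (const p) (const q) (⊥-elim ∘ ¬tt)))
... | false | true  = inj₂ (inj₂ (inj₁ (agree (affineOn-origin A) (const p) (const q) (⊥-elim ∘ ¬tt))))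
... | true  | true  = inj₂ (inj₂ (inj₂ (agree (affineOn-origin A) (const p) (const q) (⊥-elim ∘ ¬tt))))

affineOn⇒among₄-J─I : AffineOn Occ g → ¬ Occ true false → Among₄ Occ g (λ a b → b ∧ not a)
affineOn⇒among₄-J─I {g = g} A ¬tf with g false true in q | g true true in r
... | false | false = inj₁ (agree (affineOn-origin A) (⊥-elim ∘ ¬tf) (const q) (const r))
... | false | true  = inj₂ (inj₁ (agree (affineOn-origin A) (⊥-elim ∘ ¬tf) (const q) (const r)))
... | true  | true  = inj₂ (inj₂ (inj₁ (agree (affineOn-origin A) (⊥-elim ∘ ¬tf) (const q) (const r))))
... | true  | false = inj₂ (inj₂ (inj₂ (agree (affineOn-origin A) (⊥-elim ∘ ¬tf) (const q) (const r))))

affineOn⇒among₄-I─J : AffineOn Occ g → ¬ Occ false true → Among₄ Occ g (λ a b → a ∧ not b)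
affineOn⇒among₄-I─J {g = g} A ¬ft with g true false in p | g true true in r
... | false | false = inj₁ (agree (affineOn-origin A) (const p) (⊥-elim ∘ ¬ft) (const r))
... | true  | true  = inj₂ (inj₁ (agree (affineOn-origin A) (const p) (⊥-elim ∘ ¬ft) (const r)))
... | false | true  = inj₂ (inj₂ (inj₁ (agree (affineOn-origin A) (const p) (⊥-elim ∘ ¬ft) (const r))))
... | true  | false = inj₂ (inj₂ (inj₂ (agree (affineOn-origin A) (const p) (⊥-elim ∘ ¬ft) (const r))))

affineOn-⊥ : AffineOn Occ (λ _ _ → false)
affineOn-⊥ = affineOn 1ℚ 0ℚ 0ℚ refl λ { {false} {false} _ → refl ; {true}  {false} _ → refl
                                     ; {false} {true}  _ → refl ; {true}  {true}  _ → refl }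

affineOn-I : AffineOn Occ (λ a _ → a)
affineOn-I = affineOn 0ℚ 1ℚ 0ℚ refl λ { {false} {false} _ → refl ; {true}  {false} _ → refl
                                     ; {false} {true}  _ → refl ; {true}  {true}  _ → refl }

affineOn-J : AffineOn Occ (λ _ b → b)
affineOn-J = affineOn 0ℚ 0ℚ 1ℚ refl λ { {false} {false} _ → refl ; {true}  {false} _ → refl
                                     ; {false} {true}  _ → refl ; {true}  {true}  _ → refl }

affineOn-I∪J : ¬ Occ true true → AffineOn Occ _∨_
affineOn-I∪J ¬tt = affineOn (- 1ℚ) 1ℚ 1ℚ refl λ { {false} {false} _  → refl ; {true}  {false} _  → refl
                                               ; {false} {true}  _  → refl ; {true}  {true}  tt → ⊥-elim (¬tt tt) }

affineOn-J─I : ¬ Occ true false → AffineOn Occ (λ a b → b ∧ not a)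
affineOn-J─I ¬tf = affineOn 1ℚ (- 1ℚ) 1ℚ refl λ { {false} {false} _  → refl ; {true}  {false} tf → ⊥-elim (¬tf tf)
                                               ; {false} {true}  _  → refl ; {true}  {true}  _  → refl }

affineOn-I─J : ¬ Occ false true → AffineOn Occ (λ a b → a ∧ not b)
affineOn-I─J ¬ft = affineOn 1ℚ 1ℚ (- 1ℚ) refl λ { {false} {false} _  → refl ; {true}  {false} _  → refl
                                               ; {false} {true}  ft → ⊥-elim (¬ft ft) ; {true}  {true}  _  → refl }

-- Subsets cut out by patterns

lookup-─ : ∀ (p q : Subset n) i → lookup (p ─ q) i ≡ lookup p i ∧ not (lookup q i)
lookup-─ (x ∷ p) (true  ∷ q) zero    = sym (∧-zeroʳ x)
lookup-─ (x ∷ p) (false ∷ q) zero    = sym (∧-identityʳ x)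
lookup-─ (x ∷ p) (y     ∷ q) (suc i) = lookup-─ p q i

follows-⊥ : Follows I J (λ _ _ → false) ⊥
follows-⊥ = follows λ i → lookup-replicate i false

follows-I : Follows I J (λ a _ → a) I
follows-I = follows λ _ → refl

follows-J : Follows I J (λ _ b → b) J
follows-J = follows λ _ → refl

follows-I∩J : Follows I J _∧_ (I ∩ J)
follows-I∩J {I = I} {J = J} = follows λ i → lookup-zipWith _∧_ i I J

follows-I∪J : Follows I J _∨_ (I ∪ J)
follows-I∪J {I = I} {J = J} = follows λ i → lookup-zipWith _∨_ i I J

follows-I─J : Follows I J (λ a b → a ∧ not b) (I ─ J)
follows-I─J {I = I} {J = J} = follows (lookup-─ I J)

follows-J─I : Follows I J (λ a b → b ∧ not a) (J ─ I)
follows-J─I {I = I} {J = J} = follows (lookup-─ J I)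

nonempty⇔occurs : ∀ {a₀ b₀} → Follows I J g K → (∀ {a b} → g a b ≡ true → a ≡ a₀ × b ≡ b₀) →
  g a₀ b₀ ≡ true → Nonempty K ⇔ Occurs I J a₀ b₀
nonempty⇔occurs {g = g} {K = K} K≐g only hit = mk⇔
  (λ (x , x∈K) → uncurry (occurs x) (only (trans (sym (at K≐g x)) ([]=⇒lookup x∈K))))
  (λ (occurs x p q) → x , lookup⇒[]= x K (trans (at K≐g x) (trans (cong₂ g p q) hit)))

nonempty-I∩J⇔ : Nonempty (I ∩ J) ⇔ Occurs I J true true
nonempty-I∩J⇔ = nonempty⇔occurs follows-I∩J
  (λ { {true} {true} _ → refl , refl ; {true} {false} () ; {false} () }) refl

nonempty-I─J⇔ : Nonempty (I ─ J) ⇔ Occurs I J true false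
nonempty-I─J⇔ = nonempty⇔occurs follows-I─J
  (λ { {true} {false} _ → refl , refl ; {true} {true} () ; {false} () }) refl

nonempty-J─I⇔ : Nonempty (J ─ I) ⇔ Occurs I J false true
nonempty-J─I⇔ = nonempty⇔occurs follows-J─I
  (λ { {false} {true} _ → refl , refl ; {true} {true} () ; {_} {false} () }) refl

⊂⇒¬occurs : I ⊂ J → ¬ Occurs I J true false
⊂⇒¬occurs {I = I} (I⊆J , _) (occurs x p q) with () ← trans (sym q) ([]=⇒lookup (I⊆J (lookup⇒[]= x I p)))

¬occurs⇒⊂ : ¬ Occurs I J true false → Occurs I J false true → I ⊂ J
¬occurs⇒⊂ {I = I} {J = J} ¬tf (occurs x p q) = I⊆J , x , lookup⇒[]= x J q , x∉I
  where
  I⊆J : I ⊆ J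
  I⊆J {y} y∈I with lookup J y in r
  ... | true  = lookup⇒[]= y J r
  ... | false = ⊥-elim (¬tf (occurs y ([]=⇒lookup y∈I) r))
  x∉I : x ∉ I
  x∉I x∈I with () ← trans (sym p) ([]=⇒lookup x∈I)

¬occurs⇒I≡⊥ : ¬ Occurs I J true false → ¬ Occurs I J true true → I ≡ ⊥
¬occurs⇒I≡⊥ {J = J} ¬tf ¬tt =
  follows-unique {J = J} follows-I follows-⊥ (agree (λ _ → refl) (⊥-elim ∘ ¬tf) (λ _ → refl) (⊥-elim ∘ ¬tt))

¬occurs⇒J≡⊥ : ¬ Occurs I J false true → ¬ Occurs I J true true → J ≡ ⊥
¬occurs⇒J≡⊥ {I = I} ¬ft ¬tt =
  follows-unique {I = I} follows-J follows-⊥ (agree (λ _ → refl) (λ _ → refl) (⊥-elim ∘ ¬ft) (⊥-elim ∘ ¬tt))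

¬occurs⇒I≡J : ¬ Occurs I J true false → ¬ Occurs I J false true → I ≡ J
¬occurs⇒I≡J ¬tf ¬ft =
  follows-unique follows-I follows-J (agree (λ _ → refl) (⊥-elim ∘ ¬tf) (⊥-elim ∘ ¬ft) (λ _ → refl))

-- The section of the cube by the plane through v, ₋I v and ₋J v

module Section (v : Vertex n) (I J : Subset n) where

  OnPlane : Vertex n → Set
  OnPlane = InPlane v (flipSigns I v) (flipSigns J v)

  flipSigns-≡⊥ : K ≡ ⊥ → flipSigns K v ≡ v
  flipSigns-≡⊥ refl = flipSigns-⊥ v

  onPlane⇒pattern : ∀ {w} → OnPlane w → ∃ λ g → AffineOn (Occurs I J) g × Follows I J g (w ⊖ v)
  onPlane⇒pattern {w} onP =
    inAff3⇒pattern (to (inPlane⇔inAff3 v I J (w ⊖ v)) (subst OnPlane (sym (flipSigns-⊖ w v)) onP))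

  pattern⇒onPlane : AffineOn (Occurs I J) g → Follows I J g K → OnPlane (flipSigns K v)
  pattern⇒onPlane {K = K} A K≐g = from (inPlane⇔inAff3 v I J K) (pattern⇒inAff3 A K≐g)

  agree⇒≡flipSigns : ∀ {w} → Follows I J g (w ⊖ v) → Follows I J h K → Agree (Occurs I J) g h →
    w ≡ flipSigns K v
  agree⇒≡flipSigns {w = w} w≐g K≐h g≈h =
    trans (sym (flipSigns-⊖ w v)) (cong (λ K → flipSigns K v) (follows-unique w≐g K≐h g≈h))

  agree-⊥⇒≡v : ∀ {w} → Follows I J g (w ⊖ v) → Agree (Occurs I J) g (λ _ _ → false) → w ≡ v
  agree-⊥⇒≡v w≐g g≈⊥ = trans (agree⇒≡flipSigns w≐g follows-⊥ g≈⊥) (flipSigns-⊥ v)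

  among₃⇒listed : ∀ {w} → Follows I J g (w ⊖ v) → Among₃ (Occurs I J) g →
    w ≡ v ⊎ w ≡ flipSigns I v ⊎ w ≡ flipSigns J v
  among₃⇒listed w≐g =
    Sum.map (agree-⊥⇒≡v w≐g) (Sum.map (agree⇒≡flipSigns w≐g follows-I) (agree⇒≡flipSigns w≐g follows-J))

  among₄⇒listed : ∀ {w} → Follows I J g (w ⊖ v) → Follows I J h X → Among₄ (Occurs I J) g h →
    w ≡ v ⊎ w ≡ flipSigns I v ⊎ w ≡ flipSigns J v ⊎ w ≡ flipSigns X v
  among₄⇒listed w≐g X≐h =
    Sum.map (agree-⊥⇒≡v w≐g) (Sum.map (agree⇒≡flipSigns w≐g follows-I)
      (Sum.map (agree⇒≡flipSigns w≐g follows-J) (agree⇒≡flipSigns w≐g X≐h)))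

  listed₃⇒onPlane : ∀ {w} → w ≡ v ⊎ w ≡ flipSigns I v ⊎ w ≡ flipSigns J v → OnPlane w
  listed₃⇒onPlane (inj₁ refl)        = subst OnPlane (flipSigns-⊥ v) (pattern⇒onPlane affineOn-⊥ follows-⊥)
  listed₃⇒onPlane (inj₂ (inj₁ refl)) = pattern⇒onPlane affineOn-I follows-I
  listed₃⇒onPlane (inj₂ (inj₂ refl)) = pattern⇒onPlane affineOn-J follows-J

  listed₄⇒onPlane : Follows I J h X → AffineOn (Occurs I J) h →
    ∀ {w} → w ≡ v ⊎ w ≡ flipSigns I v ⊎ w ≡ flipSigns J v ⊎ w ≡ flipSigns X v → OnPlane w
  listed₄⇒onPlane X≐h Ah (inj₁ w≡v)                = listed₃⇒onPlane (inj₁ w≡v)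
  listed₄⇒onPlane X≐h Ah (inj₂ (inj₁ w≡v₁))        = listed₃⇒onPlane (inj₂ (inj₁ w≡v₁))
  listed₄⇒onPlane X≐h Ah (inj₂ (inj₂ (inj₁ w≡v₂))) = listed₃⇒onPlane (inj₂ (inj₂ w≡v₂))
  listed₄⇒onPlane X≐h Ah (inj₂ (inj₂ (inj₂ refl))) = pattern⇒onPlane Ah X≐h

  cubeSection3 : (∀ {g} → AffineOn (Occurs I J) g → Among₃ (Occurs I J) g) →
    CubeSection3 v (flipSigns I v) (flipSigns J v)
  cubeSection3 among w =
    (λ onP → let g , A , w≐g = onPlane⇒pattern onP in among₃⇒listed w≐g (among A)) , listed₃⇒onPlane

  cubeSection4 : Follows I J h X → AffineOn (Occurs I J) h →
    (∀ {g} → AffineOn (Occurs I J) g → Among₄ (Occurs I J) g h) →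
    CubeSection4 v (flipSigns I v) (flipSigns J v) (flipSigns X v)
  cubeSection4 X≐h Ah among w =
    (λ onP → let g , A , w≐g = onPlane⇒pattern onP in among₄⇒listed w≐g X≐h (among A)) ,
    listed₄⇒onPlane X≐h Ah

  case1 : ¬ Occurs I J true true → Case1 v I J
  case1 ¬tt = ¬tt ∘ to nonempty-I∩J⇔ ,
              cubeSection4 follows-I∪J (affineOn-I∪J ¬tt) (λ A → affineOn⇒among₄-I∪J A ¬tt)

  case2ˡ : ¬ Occurs I J true false → Occurs I J false true → Case2 v I J
  case2ˡ ¬tf ft = inj₁ (¬occurs⇒⊂ ¬tf ft ,
                        cubeSection4 follows-J─I (affineOn-J─I ¬tf) (λ A → affineOn⇒among₄-J─I A ¬tf))

  case2ʳ : ¬ Occurs I J false true → Occurs I J true false → Case2 v I J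
  case2ʳ ¬ft tf = inj₂ (¬occurs⇒⊂ (¬ft ∘ occurs-swap) (occurs-swap tf) ,
                        cubeSection4 follows-I─J (affineOn-I─J ¬ft) (λ A → affineOn⇒among₄-I─J A ¬ft))

  case3 : Occurs I J true true → Occurs I J true false → Occurs I J false true → Case3 v I J
  case3 tt tf ft = from nonempty-I∩J⇔ tt , from nonempty-I─J⇔ tf , from nonempty-J─I⇔ ft ,
                   cubeSection3 (λ A → affineOn⇒among₃ A tf ft tt)

  case1⊎case2⊎case3 : flipSigns I v ≢ flipSigns J v → Case1 v I J ⊎ Case2 v I J ⊎ Case3 v I J
  case1⊎case2⊎case3 v₁≢v₂ with occurs? I J true true | occurs? I J true false | occurs? I J false true
  ... | no ¬tt | _      | _      = inj₁ (case1 ¬tt)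
  ... | yes _  | no ¬tf | yes ft = inj₂ (inj₁ (case2ˡ ¬tf ft))
  ... | yes _  | no ¬tf | no ¬ft = ⊥-elim (v₁≢v₂ (cong (λ K → flipSigns K v) (¬occurs⇒I≡J ¬tf ¬ft)))
  ... | yes _  | yes tf | no ¬ft = inj₂ (inj₁ (case2ʳ ¬ft tf))
  ... | yes tt | yes tf | yes ft = inj₂ (inj₂ (case3 tt tf ft))

  ¬case1×case2 : v ≢ flipSigns I v → v ≢ flipSigns J v → ¬ (Case1 v I J × Case2 v I J)
  ¬case1×case2 v≢v₁ _ ((I∩J≡∅ , _) , inj₁ (I⊂J , _)) =
    v≢v₁ (sym (flipSigns-≡⊥ (¬occurs⇒I≡⊥ (⊂⇒¬occurs I⊂J) (I∩J≡∅ ∘ from nonempty-I∩J⇔))))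
  ¬case1×case2 _ v≢v₂ ((I∩J≡∅ , _) , inj₂ (J⊂I , _)) =
    v≢v₂ (sym (flipSigns-≡⊥ (¬occurs⇒J≡⊥ (⊂⇒¬occurs J⊂I ∘ occurs-swap)
                                            (I∩J≡∅ ∘ from nonempty-I∩J⇔))))

  ¬case1×case3 : ¬ (Case1 v I J × Case3 v I J)
  ¬case1×case3 ((I∩J≡∅ , _) , (I∩J≢∅ , _)) = I∩J≡∅ I∩J≢∅

  ¬case2×case3 : ¬ (Case2 v I J × Case3 v I J)
  ¬case2×case3 (inj₁ (I⊂J , _) , (_ , I─J≢∅ , _))     = ⊂⇒¬occurs I⊂J (to nonempty-I─J⇔ I─J≢∅)
  ¬case2×case3 (inj₂ (J⊂I , _) , (_ , _ , J─I≢∅ , _)) =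
    ⊂⇒¬occurs J⊂I (occurs-swap (to nonempty-J─I⇔ J─I≢∅))

proposition2p1 : (n : ℕ) (v v₁ v₂ : Vertex n) →
    v ≢ v₁ → v ≢ v₂ → v₁ ≢ v₂ →
    (I J : Subset n) → v₁ ≡ flipSigns I v → v₂ ≡ flipSigns J v →
    ExactlyOne (Case1 v I J) (Case2 v I J) (Case3 v I J)
proposition2p1 n v _ _ v≢v₁ v≢v₂ v₁≢v₂ I J refl refl =
  case1⊎case2⊎case3 v₁≢v₂ , ¬case1×case2 v≢v₁ v≢v₂ , ¬case1×case3 , ¬case2×case3
  where open Section v I J
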